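{- Let $\Sigma$ be a finite alphabet and $c$ a constant. If $\mathcal{Q} \subseteq \Sigma^* \times \mathbb{N}$ is a decidable parameterized problem with a kernel of size $O(k^c)$, then there is a polynomial-time quasi-order $\preceq$ on $\Sigma^* \times \mathbb{N}$ and a computable function $f\colon\mathbb{N}\to\mathbb{N}$ with $f(k)\in O(k^c)$ such that: (a) the set $\mathcal{Q}$ is a lower ideal of $\Sigma^* \times \mathbb{N}$ under $\preceq$; and (b) for every $(x,k)\notin\mathcal{Q}$ there is an obstruction $(x',k')\notin\mathcal{Q}$ of size at most $f(k)$ with $(x',k')\preceq(x,k)$.
   Context: A parameterized problem is a subset $\mathcal{Q}\subseteq\Sigma^*\times\mathbb{N}$; the second component of an instance $(x,k)$ is the parameter. The size of an instance $(x,k)\in\Sigma^*\times\mathbb{N}$ is $|(x,k)| := |x|+k$. A kernelization algorithm (kernel) of size $g\colon\mathbb{N}\to\mathbb{N}$ for $\mathcal{Q}$ is a polynomial-time algorithm (polynomial in the size $|x|+k$) that, on input $(x,k)\in\Sigma^*\times\mathbb{N}$, outputs an instance $(x',k')$ of size at most $g(k)$ such that $(x,k)\in\mathcal{Q}\Leftrightarrow(x',k')\in\mathcal{Q}$. A quasi-order is a reflexive and transitive binary relation $\preceq$ on a set. A quasi-order $\preceq$ is polynomial-time if there is an algorithm that decides whether $y\preceq z$ in $O((|y|+|z|)^{O(1)})$ time, where for an instance $y=(x,k)\in\Sigma^*\times\mathbb{N}$ the notation $|y|$ denotes its size $|(x,k)| = |x|+k$ (and likewise for $z$). If $S$ is a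 subset of a universe $U$ and $\preceq$ is a quasi-order on $U$, then $S$ is a lower ideal of $U$ under $\preceq$ if $y\in S$ and $y'\preceq y$ together imply $y'\in S$. -}

module Defs where

open import Data.Bool.Base using (Bool; if_then_else_)
open import Data.Fin.Base using (Fin)
open import Data.List.Base as List using (List; []; _∷_; _++_; length; map)
open import Data.Maybe.Base using (Maybe; nothing; just)
open import Data.Nat.Base using (ℕ; zero; suc; _+_; _*_; _^_; _≤_)
open import Data.Product.Base using (_×_; _,_; proj₂; ∃-syntax)
open import Data.Vec.Base as Vec using (Vec; lookup; head; _∷_; _[_]≔_)
open import Function.Bundles using (_⇔_)
open import Level using (0ℓ)
open import Relation.Binary.Core using (Rel)
open import Relation.Binary.PropositionalEquality.Core using (_≡_)
open import Relation.Nullary.Reflects using (Reflects)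
open import Relation.Unary using (Pred)

-- Asymptotic: finitely many arguments are exempt.

infix 4 _∈O_

_∈O_ : (ℕ → ℕ) → (ℕ → ℕ) → Set
f ∈O h = ∃[ C ] ∃[ n₀ ] (∀ n → n₀ ≤ n → f n ≤ C * h n)

-- Algorithms are deterministic multi-stack machines: a finite control acting
-- on finitely many stacks over a finite alphabet, one push or pop per step.
-- A Turing tape is two stacks and a stack is one tape, so these machines and
-- multi-tape Turing machines simulate each other in linear time.

-- The stack alphabet: the s letters of the alphabet of the problem, a unary
-- digit, a separator, and w further symbols chosen by the machine.

data Symbol (s w : ℕ) : Set where
  letter : Fin s → Symbol s w
  tally  : Symbol s w
  #      : Symbol s w
  work   : Fin w → Symbol s w

-- In pop i goto, the next label depends on the symbol removed from stack i,
-- which is nothing if that stack is empty (it then stays empty).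

data Instruction (s w stacks labels : ℕ) : Set where
  push : Fin stacks → Symbol s w → Fin labels → Instruction s w stacks labels
  pop  : Fin stacks → (Maybe (Symbol s w) → Fin labels) →
         Instruction s w stacks labels
  halt : Instruction s w stacks labels

record Machine (s : ℕ) : Set where
  field
    {w}           : ℕ
    {extraStacks} : ℕ
    {labels}      : ℕ
    start         : Fin labels
    code          : Fin labels → Instruction s w (suc extraStacks) labels

  Word : Set
  Word = List (Symbol s w)

  Store : Set
  Store = Vec Word (suc extraStacks)

  Config : Set
  Config = Fin labels × Store

  execute : Instruction s w (suc extraStacks) labels → Store → Maybe Config
  execute (push i a l) σ = just (l , σ [ i ]≔ (a ∷ lookup σ i))
  execute (pop i goto) σ =
    just (goto (List.head (lookup σ i)) , σ [ i ]≔ List.drop 1 (lookup σ i))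
  execute halt         σ = nothing

  step : Config → Maybe Config
  step (l , σ) = execute (code l) σ

  data _⇓[_]_ : Config → ℕ → Store → Set where
    stop : ∀ {c} → step c ≡ nothing → c ⇓[ 0 ] proj₂ c
    next : ∀ {c c′ t σ} → step c ≡ just c′ → c′ ⇓[ t ] σ → c ⇓[ suc t ] σ

  -- The input is on the first stack, its first symbol on top, and the output
  -- is read off the first stack; the contents of the others are then ignored.

  _computes_inTime_ : Word → Word → ℕ → Set
  _computes_inTime_ u v t =
    ∃[ σ ] ((start , u ∷ Vec.replicate extraStacks []) ⇓[ t ] σ × head σ ≡ v)

module _ {s w : ℕ} where

  encodeℕ : ℕ → List (Symbol s w)
  encodeℕ n = List.replicate n tally

  encodeBool : Bool → List (Symbol s w)
  encodeBool b = if b then tally ∷ [] else []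

-- Σ* × ℕ for the alphabet Fin s.

Instance : ℕ → Set
Instance s = List (Fin s) × ℕ

parameter : ∀ {s} → Instance s → ℕ
parameter = proj₂

size : ∀ {s} → Instance s → ℕ
size (x , k) = length x + k

-- The parameter is in unary, so the code of an instance has length equal to
-- its size.

encode : ∀ {s w} → Instance s → List (Symbol s w)
encode (x , k) = map letter x ++ encodeℕ k

encodePair : ∀ {s w} → Instance s → Instance s → List (Symbol s w)
encodePair y z = encode y ++ # ∷ encode z

ParameterizedProblem : ℕ → Set₁
ParameterizedProblem s = Pred (Instance s) 0ℓ

Computable : (ℕ → ℕ) → Set
Computable f = ∃[ M ] let open Machine {0} M in
  ∀ n → ∃[ t ] (encodeℕ n computes encodeℕ (f n) inTime t)

DecidableProblem : ∀ {s} → ParameterizedProblem s → Set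
DecidableProblem {s} Q = ∃[ M ] let open Machine {s} M in
  ∀ y → ∃[ b ] ∃[ t ]
    (encode y computes encodeBool b inTime t × Reflects (Q y) b)

PolynomiallyBounded : (ℕ → ℕ) → Set
PolynomiallyBounded T = ∃[ d ] (T ∈O (_^ d))

PolynomialTimeRelation : ∀ {s} → Rel (Instance s) 0ℓ → Set
PolynomialTimeRelation {s} _≼_ =
  ∃[ M ] ∃[ T ] (PolynomiallyBounded T × let open Machine {s} M in
    ∀ y z → ∃[ b ] ∃[ t ]
      (encodePair y z computes encodeBool b inTime t ×
       t ≤ T (size y + size z) × Reflects (y ≼ z) b))

Kernel : ∀ {s} → ParameterizedProblem s → (ℕ → ℕ) → Set
Kernel {s} Q g =
  ∃[ M ] ∃[ T ] (PolynomiallyBounded T × let open Machine {s} M in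
    ∀ y → ∃[ y′ ] ∃[ t ]
      (encode y computes encode y′ inTime t ×
       t ≤ T (size y) × size y′ ≤ g (parameter y) × Q y ⇔ Q y′))

LowerIdeal : {U : Set} → Rel U 0ℓ → Pred U 0ℓ → Set
LowerIdeal _≼_ S = ∀ {y y′} → S y → y′ ≼ y → S y′

{-# OPTIONS --safe #-}

-- Let K be the kernelization.  Put y′ ≼ y if y′ is reached from y by applying K
-- repeatedly, where each application must decrease the size.  K preserves
-- membership and non-membership, so Q is a lower ideal, and for y ∉ Q either
-- K y is smaller than y and is the obstruction, or y is no larger than K y and
-- is itself small.  Since sizes decrease, a chain from y has at most 1 + |y|
-- members, and following it decides ≼ in polynomial time.

module Submission where

open import Defs
open import Data.Bool.Base using (Bool; true; false; if_then_else_)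
open import Data.Empty using (⊥)
open import Data.Fin.Base using (Fin; zero; suc; _↑ʳ_)
import Data.Fin.Properties as Fin
open import Data.List.Base as List
  using (List; []; _∷_; _ʳ++_; allFin; concatMap; drop; length; reverse)
open import Data.List.Membership.Propositional using (_∈_; lose)
open import Data.List.Membership.Propositional.Properties
  using (∈-map⁺; ∈-++⁺ˡ; ∈-++⁺ʳ; ∈-concatMap⁺; ∈-allFin)
open import Data.List.Properties
  using (∷-injective; drop-[]; length-++; length-drop; length-map; length-replicate;
         length-reverse; reverse-injective; reverse-involutive)
open import Data.List.Relation.Unary.All as All using (All; []; _∷_)
import Data.List.Relation.Unary.All.Properties as All
open import Data.List.Relation.Unary.Any using (here; there; index)
open import Data.List.Relation.Unary.Any.Properties using (lookup-index)
open import Data.Maybe.Base as Maybe using (Maybe; nothing; just; maybe; is-nothing)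
open import Data.Nat.Base
open import Data.Nat.Properties
open import Data.Product.Base
open import Data.Sum.Base using (_⊎_; inj₁; inj₂)
open import Data.Unit.Base using (⊤; tt)
open import Data.Vec.Base as Vec using (Vec; []; _∷_; lookup; _[_]≔_)
open import Data.Vec.Properties using (lookup-++ʳ; []≔-++-↑ʳ)
open import Function.Base using (_∘_; const; flip)
open import Function.Bundles using (_⇔_; module Equivalence)
open import Level using (0ℓ)
open import Relation.Binary.Construct.Closure.ReflexiveTransitive using (Star; ε; _◅_)
import Relation.Binary.Construct.Closure.ReflexiveTransitive.Properties as Star
import Relation.Binary.Construct.Flip.EqAndOrd as Flip
open import Relation.Binary.Core using (Rel)
open import Relation.Binary.PropositionalEquality
open import Relation.Binary.Structures using (IsPreorder)
open import Relation.Nullary.Decidable using (Dec; yes; no; does; map′)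
open import Relation.Nullary.Negation.Core using (¬_; contradiction)
open import Relation.Nullary.Reflects using (Reflects; ofʸ; ofⁿ)

-- Structured programs and their compilation to machines

-- Without the demand that sizes decrease, the orbit of an instance under `K` could cycle or grow,
-- and nothing would bound the search through it. With it, every call of `K` in a chain costs at
-- most what is allowed for the size of the first instance. Polynomial time and computability refer
-- to concrete stack machines, so machines have to be exhibited. They are written in a small
-- structured language whose big-step semantics counts steps, and one simulation theorem turns a run
-- with its cost into a machine run that is no longer. `K` is an arbitrary machine; it enters as a
-- call on stacks of its own, and whatever it leaves there has to be erased before the next call.
-- The time bound of `K` and the size bound of the kernel are arbitrary functions, controlled only
-- from some argument on. Both are replaced by functions `D + C n^d` that bound them everywhere.

Enumeration : Set → Set
Enumeration A = Σ[ xs ∈ List A ] (∀ x → x ∈ xs)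

enum-⊤ : Enumeration ⊤
enum-⊤ = tt ∷ [] , λ _ → here refl

enum-Maybe : ∀ {A} → Enumeration A → Enumeration (Maybe A)
enum-Maybe (xs , ∈xs) = nothing ∷ List.map just xs , λ where
  nothing  → here refl
  (just x) → there (∈-map⁺ just (∈xs x))

enum-⊎ : ∀ {A B} → Enumeration A → Enumeration B → Enumeration (A ⊎ B)
enum-⊎ (xs , ∈xs) (ys , ∈ys) = List.map inj₁ xs List.++ List.map inj₂ ys , λ where
  (inj₁ x) → ∈-++⁺ˡ (∈-map⁺ inj₁ (∈xs x))
  (inj₂ y) → ∈-++⁺ʳ _ (∈-map⁺ inj₂ (∈ys y))

enum-Σ : ∀ {A} {B : A → Set} →
         Enumeration A → (∀ x → Enumeration (B x)) → Enumeration (Σ A B)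
enum-Σ (xs , ∈xs) ys =
  concatMap (λ x → List.map (x ,_) (proj₁ (ys x))) xs ,
  λ (x , y) → ∈-concatMap⁺ _ (lose (∈xs x) (∈-map⁺ (x ,_) (proj₂ (ys x) y)))

enum-Symbol : ∀ {s w} → Enumeration (Symbol s w)
enum-Symbol =
  tally ∷ # ∷ List.map letter (allFin _) List.++ List.map work (allFin _) , λ where
    tally      → here refl
    #          → there (here refl)
    (letter a) → there (there (∈-++⁺ˡ (∈-map⁺ letter (∈-allFin a))))
    (work a)   → there (there (∈-++⁺ʳ _ (∈-map⁺ work (∈-allFin a))))

module Programs (s w k e : ℕ) where

  stacks : ℕ
  stacks = suc (k + suc e)

  Word : Set
  Word = List (Symbol s w)

  Store : Set
  Store = Vec Word stacks

  Code : ℕ → Set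
  Code l = Fin l → Instruction s w (suc e) l

  machine : ∀ {l} → Fin l → Code l → Machine s
  machine start code = record { start = start ; code = code }

  -- A loop pops a stack and stops or runs its body according to the symbol
  -- removed.  A call runs a machine on the last suc e stacks.

  infixr 5 _⨾_

  data Program : Set where
    skip : Program
    push : Fin stacks → Symbol s w → Program
    _⨾_  : Program → Program → Program
    case : Fin stacks → (Maybe (Symbol s w) → Program) → Program
    loop : Fin stacks → (Maybe (Symbol s w) → Bool) →
           (Maybe (Symbol s w) → Program) → Program
    call : ∀ {l} → Fin l → Code l → Program

  top : Store → Fin stacks → Maybe (Symbol s w)
  top σ i = List.head (lookup σ i)

  popped : Store → Fin stacks → Store
  popped σ i = σ [ i ]≔ List.drop 1 (lookup σ i)

  infix 4 _⊢_⟶[_]_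

  -- Because of `weaken` the index is an upper bound on the cost, so that branches of different
  -- length can share one cost that does not depend on the data.
  data _⊢_⟶[_]_ : Program → Store → ℕ → Store → Set where
    weaken : ∀ {p σ σ′ t t′} → t ≤ t′ →
             p ⊢ σ ⟶[ t ] σ′ → p ⊢ σ ⟶[ t′ ] σ′
    skip   : ∀ {σ} → skip ⊢ σ ⟶[ 0 ] σ
    push   : ∀ {i a σ} → push i a ⊢ σ ⟶[ 1 ] σ [ i ]≔ (a ∷ lookup σ i)
    _⨾_    : ∀ {p q σ σ′ σ″ t t′} →
             p ⊢ σ ⟶[ t ] σ′ → q ⊢ σ′ ⟶[ t′ ] σ″ → p ⨾ q ⊢ σ ⟶[ t + t′ ] σ″
    case   : ∀ {i f σ σ′ t} →
             f (top σ i) ⊢ popped σ i ⟶[ t ] σ′ → case i f ⊢ σ ⟶[ suc t ] σ′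
    exit   : ∀ {i stop f σ} → stop (top σ i) ≡ true →
             loop i stop f ⊢ σ ⟶[ 1 ] popped σ i
    again  : ∀ {i stop f σ σ′ σ″ t t′} → stop (top σ i) ≡ false →
             f (top σ i) ⊢ popped σ i ⟶[ t ] σ′ →
             loop i stop f ⊢ σ′ ⟶[ t′ ] σ″ →
             loop i stop f ⊢ σ ⟶[ suc (t + t′) ] σ″
    call   : ∀ {l start t τ τ′} {code : Code l} (ρ : Vec Word (suc k)) →
             Machine._⇓[_]_ (machine start code) (start , τ) t τ′ →
             call start code ⊢ ρ Vec.++ τ ⟶[ t ] ρ Vec.++ τ′

  each : Fin stacks → (Symbol s w → Program) → Program
  each i f = loop i is-nothing (maybe f skip)

  clear : Fin stacks → Program
  clear i = each i (const skip)

  move : Fin stacks → Fin stacks → Program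
  move i j = each i (push j)

  clearAll : ∀ {j} → (Fin j → Fin stacks) → Program
  clearAll {zero}  ι = skip
  clearAll {suc j} ι = clear (ι zero) ⨾ clearAll (ι ∘ suc)

  -- Costs of loops, transfers and clearing

  again-∷ : ∀ {i stop f σ σ′ σ″ a u v t t′} →
            lookup σ i ≡ a ∷ u → σ [ i ]≔ u ≡ v → stop (just a) ≡ false →
            f (just a) ⊢ v ⟶[ t ] σ′ → loop i stop f ⊢ σ′ ⟶[ t′ ] σ″ →
            loop i stop f ⊢ σ ⟶[ suc (t + t′) ] σ″
  again-∷ {i} {stop} {f} {σ} {σ′} {t = t} eq refl go run =
    again (trans (cong (stop ∘ List.head) eq) go)
      (subst (λ v → f (List.head v) ⊢ σ [ i ]≔ List.drop 1 v ⟶[ t ] σ′) (sym eq) run)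

  exit-[] : ∀ {i stop f σ σ′} →
            lookup σ i ≡ [] → σ [ i ]≔ [] ≡ σ′ → stop nothing ≡ true →
            loop i stop f ⊢ σ ⟶[ 1 ] σ′
  exit-[] {i} {stop} {f} {σ} eq refl halted =
    subst (λ v → loop i stop f ⊢ σ ⟶[ 1 ] σ [ i ]≔ List.drop 1 v) eq
      (exit (trans (cong (stop ∘ List.head) eq) halted))

  arrive : ∀ {p ρ t σ σ′} → σ ≡ σ′ → p ⊢ ρ ⟶[ t ] σ → p ⊢ ρ ⟶[ t ] σ′
  arrive refl run = run

  -- `S u x` views the store as the word `u` on stack `i` and a loop state `x` for the rest; the
  -- first two hypotheses say that it is such a view. The cost refers to a bound `N` on the length,
  -- which lets all later costs be functions of a bound on the sizes alone.
  each-run : ∀ {X : Set} {i f c N} (S : Word → X → Store) (h : X → Symbol s w → X) →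
    (∀ u x → lookup (S u x) i ≡ u) → (∀ u v x → S u x [ i ]≔ v ≡ S v x) →
    (∀ a u x → f a ⊢ S u x ⟶[ c ] S u (h x a)) →
    ∀ u x → length u ≤ N → each i f ⊢ S u x ⟶[ suc (N * suc c) ] S [] (List.foldl h x u)
  each-run S h get set body [] x z≤n =
    weaken (s≤s z≤n) (exit-[] (get [] x) (set [] [] x) refl)
  each-run {N = suc N} S h get set body (a ∷ u) x (s≤s u≤N) =
    weaken (s≤s (≤-reflexive (+-suc _ _)))
      (again-∷ (get (a ∷ u) x) (set (a ∷ u) u x) refl (body a u x)
        (each-run S h get set body u (h x a) u≤N))

  clear-run : ∀ {i N} (S : Word → Store) →
    (∀ u → lookup (S u) i ≡ u) → (∀ u v → S u [ i ]≔ v ≡ S v) →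
    ∀ u → length u ≤ N → clear i ⊢ S u ⟶[ suc (N * 1) ] S []
  clear-run S get set u =
    each-run {X = ⊤} (λ u _ → S u) _ (λ u _ → get u) (λ u v _ → set u v)
      (λ _ _ _ → skip) u tt

  move-run : ∀ {i j N} (S : Word → Word → Store) →
    (∀ u v → lookup (S u v) i ≡ u) → (∀ u u′ v → S u v [ i ]≔ u′ ≡ S u′ v) →
    (∀ u v → lookup (S u v) j ≡ v) → (∀ u v v′ → S u v [ j ]≔ v′ ≡ S u v′) →
    ∀ u v → length u ≤ N → move i j ⊢ S u v ⟶[ suc (N * 2) ] S [] (u List.ʳ++ v)
  move-run {i} {j} S getᵢ setᵢ getⱼ setⱼ =
    each-run S (flip _∷_) getᵢ setᵢ λ a u v →
      arrive
        (trans (cong (λ x → S u v [ j ]≔ (a ∷ x)) (getⱼ u v)) (setⱼ u v (a ∷ v))) push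

  total : ∀ {j} → Vec Word j → ℕ
  total []      = 0
  total (u ∷ τ) = length u + total τ

  clearAll-run : ∀ {j} {ι : Fin j → Fin stacks} (S : Vec Word j → Store) →
    (∀ τ i → lookup (S τ) (ι i) ≡ lookup τ i) →
    (∀ τ i v → S τ [ ι i ]≔ v ≡ S (τ [ i ]≔ v)) →
    ∀ τ → clearAll ι ⊢ S τ ⟶[ total τ + j ] S (Vec.replicate j [])
  clearAll-run S get set [] = skip
  clearAll-run {suc j} S get set (u ∷ τ) =
    weaken (≤-reflexive cost)
      (clear-run (λ v → S (v ∷ τ)) (λ v → get (v ∷ τ) zero)
         (λ v v′ → set (v ∷ τ) zero v′) u ≤-refl
       ⨾ clearAll-run (λ τ → S ([] ∷ τ)) (λ τ i → get ([] ∷ τ) (suc i))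
           (λ τ i → set ([] ∷ τ) (suc i)) τ)
    where
    open ≡-Reasoning
    cost : suc (length u * 1) + (total τ + j) ≡ length u + total τ + suc j
    cost = begin
      suc (length u * 1) + (total τ + j) ≡⟨ cong (λ n → suc n + (total τ + j))
                                              (*-identityʳ (length u)) ⟩
      suc (length u + (total τ + j))     ≡⟨ cong suc (+-assoc (length u) (total τ) j) ⟨
      suc (length u + total τ + j)       ≡⟨ +-suc (length u + total τ) j ⟨
      length u + total τ + suc j         ∎

  total-push : ∀ {j} (τ : Vec Word j) i a → total (τ [ i ]≔ (a ∷ lookup τ i)) ≡ suc (total τ)
  total-push (u ∷ τ) zero    a = refl
  total-push (u ∷ τ) (suc i) a =
    trans (cong (length u +_) (total-push τ i a)) (+-suc (length u) (total τ))

  total-pop : ∀ {j} (τ : Vec Word j) i → total (τ [ i ]≔ List.drop 1 (lookup τ i)) ≤ total τ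
  total-pop ([] ∷ τ)      zero    = ≤-refl
  total-pop ((a ∷ u) ∷ τ) zero    = n≤1+n _
  total-pop (u ∷ τ)       (suc i) = +-monoʳ-≤ (length u) (total-pop τ i)

  -- A step adds at most one symbol to the store. This bounds the output of a called machine and the
  -- junk on its other stacks, hence the cost of measuring the one and erasing the other.
  total-run : ∀ {l} {start : Fin l} {code : Code l} {x τ t τ′} →
              Machine._⇓[_]_ (machine start code) (x , τ) t τ′ → total τ′ ≤ total τ + t
  total-run {τ = τ} (Machine.stop _) = m≤m+n (total τ) 0
  total-run {code = code} {x} (Machine.next eq run) with code x
  total-run {τ = τ} (Machine.next {t = t} refl run) | push i a y =
    ≤-trans (total-run run)
      (≤-reflexive (trans (cong (_+ t) (total-push τ i a)) (sym (+-suc (total τ) t))))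
  total-run {τ = τ} (Machine.next {t = t} refl run) | pop i f =
    ≤-trans (total-run run) (+-mono-≤ (total-pop τ i) (n≤1+n t))

  total-replicate : ∀ j → total (Vec.replicate j []) ≡ 0
  total-replicate zero    = refl
  total-replicate (suc j) = total-replicate j

  -- Translation of programs into labelled commands

  Label : Program → Set
  Label skip           = ⊥
  Label (push i a)     = ⊤
  Label (p ⨾ q)        = Label p ⊎ Label q
  -- Here and for loops, `nothing` labels the pop itself and `just (x , l)` is the label `l` of the
  -- branch for `x`.
  Label (case i f)     = Maybe (Σ (Maybe (Symbol s w)) (Label ∘ f))
  Label (loop i _ f)   = Maybe (Σ (Maybe (Symbol s w)) (Label ∘ f))
  Label (call {l} _ _) = Fin l

  labels : ∀ p → Enumeration (Label p)
  labels skip         = [] , λ ()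
  labels (push i a)   = enum-⊤
  labels (p ⨾ q)      = enum-⊎ (labels p) (labels q)
  labels (case i f)   = enum-Maybe (enum-Σ (enum-Maybe enum-Symbol) (labels ∘ f))
  labels (loop i _ f) = enum-Maybe (enum-Σ (enum-Maybe enum-Symbol) (labels ∘ f))
  labels (call _ _)   = allFin _ , ∈-allFin

  -- With labels in an arbitrary type, a part is placed into a larger program by relabelling its
  -- jumps; numbers are assigned only once, to the complete program.
  data Command (L : Set) : Set where
    push : Fin stacks → Symbol s w → L → Command L
    pop  : Fin stacks → (Maybe (Symbol s w) → L) → Command L
    halt : Command L

  mapCommand : ∀ {L L′} → (L → L′) → Command L → Command L′
  mapCommand g (push i a l) = push i a (g l)
  mapCommand g (pop i f)    = pop i (g ∘ f)
  mapCommand g halt         = halt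

  assemble : ∀ {L n} → (L → Fin n) → Command L → Instruction s w stacks n
  assemble g (push i a l) = push i a (g l)
  assemble g (pop i f)    = pop i (g ∘ f)
  assemble g halt         = halt

  assemble-map : ∀ {L L′ n} (g : L′ → Fin n) (h : L → L′) c →
                 assemble g (mapCommand h c) ≡ assemble (g ∘ h) c
  assemble-map g h (push i a l) = refl
  assemble-map g h (pop i f)    = refl
  assemble-map g h halt         = refl

  -- Jumping to a halting label of a called machine is leaving the call.

  resolve : ∀ {l} → Code l → Fin l → Maybe (Fin l)
  resolve code x with code x
  ... | halt = nothing
  ... | _    = just x

  shift : ∀ {l} → Code l → Instruction s w (suc e) l → Command (Maybe (Fin l))
  shift code (push i a x) = push (suc k ↑ʳ i) a (resolve code x)
  shift code (pop i f)    = pop (suc k ↑ʳ i) (resolve code ∘ f)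
  -- Control never arrives here, since `resolve` redirects every jump to a halting label to the
  -- exit.
  shift code halt         = halt

  -- The label nothing is the exit of a program, which is its entry too if the
  -- program is empty.

  entry : ∀ p → Maybe (Label p)

  -- The point of these four embeddings is where they send the exit of a part: for a first part to
  -- the entry of the second, for a second part or a branch to the exit of the whole, for a loop
  -- body back to the pop of the loop.
  inFirst : ∀ p q → Maybe (Label p) → Maybe (Label (p ⨾ q))
  inFirst p q = maybe (just ∘ inj₁) (Maybe.map inj₂ (entry q))

  inSecond : ∀ p q → Maybe (Label q) → Maybe (Label (p ⨾ q))
  inSecond p q = Maybe.map inj₂

  inBranch : ∀ {i} f x → Maybe (Label (f x)) → Maybe (Label (case i f))
  inBranch f x = Maybe.map (just ∘ (x ,_))

  inBody : ∀ {i stop} f x → Maybe (Label (f x)) → Maybe (Label (loop i stop f))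
  inBody f x = just ∘ Maybe.map (x ,_)

  entry skip              = nothing
  entry (push i a)        = just tt
  entry (p ⨾ q)           = inFirst p q (entry p)
  entry (case i f)        = just nothing
  entry (loop i _ f)      = just nothing
  entry (call start code) = resolve code start

  command : ∀ p → Label p → Command (Maybe (Label p))
  command (push i a)      _              = push i a nothing
  command (p ⨾ q)         (inj₁ l)       = mapCommand (inFirst p q) (command p l)
  command (p ⨾ q)         (inj₂ l)       = mapCommand (inSecond p q) (command q l)
  command (case i f)      nothing        = pop i (λ x → inBranch {i} f x (entry (f x)))
  command (case i f)      (just (x , l)) = mapCommand (inBranch {i} f x) (command (f x) l)
  command (loop i stop f) nothing        =
    pop i (λ x → if stop x then nothing else inBody {i} {stop} f x (entry (f x)))
  command (loop i stop f) (just (x , l)) =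
    mapCommand (inBody {i} {stop} f x) (command (f x) l)
  command (call _ code)   x              = shift code (code x)

  -- Simulation of programs by machines

  module Simulation {n} (start : Fin n) (code : Fin n → Instruction s w stacks n) where

    target : Machine s
    target = record { start = start ; code = code }

    open Machine target using (Config; _⇓[_]_; next; execute)

    infix 4 _⇓≤[_]_

    _⇓≤[_]_ : Config → ℕ → Store → Set
    c ⇓≤[ t ] σ = ∃[ t′ ] (t′ ≤ t × c ⇓[ t′ ] σ)

    -- Nothing is asked of the code at `g nothing`: the exit lies wherever the surrounding program
    -- continues.
    Implements : ∀ p → (Maybe (Label p) → Fin n) → Set
    Implements p g = ∀ l → code (g (just l)) ≡ assemble g (command p l)

    ⇓-step : ∀ {l c σ c′ t ρ} → code l ≡ c → execute c σ ≡ just c′ →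
             c′ ⇓≤[ t ] ρ → (l , σ) ⇓≤[ suc t ] ρ
    ⇓-step refl eq (t , t≤ , r) = suc t , s≤s t≤ , next eq r

    ⇓-weaken : ∀ {c t t′ ρ} → t ≤ t′ → c ⇓≤[ t ] ρ → c ⇓≤[ t′ ] ρ
    ⇓-weaken t≤t′ (u , u≤t , r) = u , ≤-trans u≤t t≤t′ , r

    implements-part : ∀ {p} q (h : Maybe (Label p) → Maybe (Label q)) g
      (ι : Label p → Label q) → (∀ l → h (just l) ≡ just (ι l)) →
      (∀ l → command q (ι l) ≡ mapCommand h (command p l)) →
      Implements q g → Implements p (g ∘ h)
    implements-part {p} q h g ι h-just eq imp l = begin
      code (g (h (just l)))                   ≡⟨ cong (code ∘ g) (h-just l) ⟩
      code (g (just (ι l)))                   ≡⟨ imp (ι l) ⟩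
      assemble g (command q (ι l))            ≡⟨ cong (assemble g) (eq l) ⟩
      assemble g (mapCommand h (command p l)) ≡⟨ assemble-map g h (command p l) ⟩
      assemble (g ∘ h) (command p l)          ∎
      where open ≡-Reasoning

    simulate-call : ∀ {l} {start : Fin l} {code′ : Code l} g →
      Implements (call start code′) g → (ρ : Vec Word (suc k)) →
      ∀ {x t τ τ′ t₀ σ} → Machine._⇓[_]_ (machine start code′) (x , τ) t τ′ →
      (g nothing , ρ Vec.++ τ′) ⇓≤[ t₀ ] σ →
      (g (resolve code′ x) , ρ Vec.++ τ) ⇓≤[ t + t₀ ] σ
    simulate-call {code′ = code′} g imp ρ {x} {τ = τ} (Machine.stop eq) r with code′ x
    -- As `x` is a halting label, `resolve` has already led to the exit, and no step is spent on
    -- leaving the call.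
    ... | halt = r
    simulate-call {code′ = code′} g imp ρ {x} {τ = τ} (Machine.next eq run) r
      with code′ x | imp x
    simulate-call g imp ρ {τ = τ} (Machine.next refl run) r | push i a y | eq =
      ⇓-step eq
        (cong (λ v → just (_ , v))
          (trans (cong (λ v → (ρ Vec.++ τ) [ suc k ↑ʳ i ]≔ (a ∷ v)) (lookup-++ʳ ρ τ i))
                 ([]≔-++-↑ʳ ρ τ i)))
        (simulate-call g imp ρ run r)
    simulate-call {code′ = code′} g imp ρ {τ = τ} (Machine.next refl run) r | pop i f | eq =
      ⇓-step eq
        (trans
          (cong (λ v → just (g (resolve code′ (f (List.head v))) ,
                             (ρ Vec.++ τ) [ suc k ↑ʳ i ]≔ List.drop 1 v))
            (lookup-++ʳ ρ τ i))
          (cong (λ v → just (_ , v)) ([]≔-++-↑ʳ ρ τ i)))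
        (simulate-call g imp ρ run r)

    -- In continuation form: a run from the exit is given, and the run of `p` is put in front of it.
    -- Sequencing then becomes nesting, and a loop body continues with the remaining derivation of
    -- the same loop.
    simulate : ∀ {p σ t σ′} g → Implements p g → p ⊢ σ ⟶[ t ] σ′ →
               ∀ {t₀ ρ} → (g nothing , σ′) ⇓≤[ t₀ ] ρ →
               (g (entry p) , σ) ⇓≤[ t + t₀ ] ρ
    simulate g imp (weaken t≤ run) {t₀} r =
      ⇓-weaken (+-monoˡ-≤ t₀ t≤) (simulate g imp run r)
    simulate g imp skip r = r
    simulate g imp push r = ⇓-step (imp tt) refl r
    simulate {p ⨾ q} g imp (_⨾_ {t = t} {t′} run run′) {t₀} r =
      ⇓-weaken (≤-reflexive (sym (+-assoc t t′ t₀)))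
        (simulate (g ∘ inFirst p q)
          (implements-part (p ⨾ q) (inFirst p q) g inj₁ (λ _ → refl) (λ _ → refl) imp) run
          (simulate (g ∘ inSecond p q)
            (implements-part (p ⨾ q) (inSecond p q) g inj₂ (λ _ → refl) (λ _ → refl) imp) run′ r))
    simulate {case i f} {σ} g imp (case run) r =
      ⇓-step (imp nothing) refl
        (simulate (g ∘ inBranch {i} f x)
          (implements-part (case i f) (inBranch {i} f x) g (just ∘ (x ,_))
            (λ _ → refl) (λ _ → refl) imp) run r)
      where x = top σ i
    simulate {loop i stop f} {σ} g imp (exit eq) r =
      ⇓-step (imp nothing)
        (cong (λ b → just (g (if b then nothing else _) , popped σ i)) eq) r
    simulate {loop i stop f} {σ} g imp (again {t = t} {t′} eq run run′) {t₀} r =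
      ⇓-step (imp nothing)
        (cong (λ b → just (g (if b then nothing else _) , popped σ i)) eq)
        (⇓-weaken (≤-reflexive (sym (+-assoc t t′ t₀)))
          (simulate (g ∘ inBody {i} {stop} f x)
            (implements-part (loop i stop f) (inBody {i} {stop} f x) g (just ∘ (x ,_))
              (λ _ → refl) (λ _ → refl) imp) run
            (simulate g imp run′ r)))
      where x = top σ i
    simulate g imp (call ρ run) r = simulate-call g imp ρ run r

  module Compile (p : Program) where

    enum : Enumeration (Maybe (Label p))
    enum = enum-Maybe (labels p)

    -- The proof of membership selects one position for each label, so repetitions in the list would
    -- do no harm.
    number : Maybe (Label p) → Fin (List.length (proj₁ enum))
    number l = index (proj₂ enum l)

    instruction : Maybe (Label p) → Instruction s w stacks (List.length (proj₁ enum))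
    instruction nothing  = halt
    instruction (just l) = assemble number (command p l)

    instructions : Fin (List.length (proj₁ enum)) → Instruction s w stacks _
    instructions x = instruction (List.lookup (proj₁ enum) x)

    instructions-number : ∀ l → instructions (number l) ≡ instruction l
    instructions-number l = cong instruction (sym (lookup-index (proj₂ enum l)))

    compiled : Machine s
    compiled = record { start = number (entry p) ; code = instructions }

    open Machine compiled using (_computes_inTime_; stop; step)

    compiled-correct : ∀ {u t σ} →
      p ⊢ u ∷ Vec.replicate (k + suc e) [] ⟶[ t ] σ →
      ∃[ t′ ] (u computes Vec.head σ inTime t′ × t′ ≤ t)
    compiled-correct {t = t} {σ} run =
      let t′ , t′≤ , r = simulate number (λ l → instructions-number (just l)) run
                           (0 , z≤n , stop halted)
      in t′ , (σ , r , refl) , ≤-trans t′≤ (≤-reflexive (+-identityʳ t))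
      where
      open Simulation (number (entry p)) instructions
      halted : step (number nothing , σ) ≡ nothing
      halted = cong (λ c → Machine.execute compiled c σ) (instructions-number nothing)

-- A program deciding the quasi-order

_≟ˢ_ : ∀ {s w} (a b : Symbol s w) → Dec (a ≡ b)
letter a ≟ˢ letter b = map′ (cong letter) (λ where refl → refl) (a Fin.≟ b)
letter _ ≟ˢ tally    = no λ ()
letter _ ≟ˢ #        = no λ ()
letter _ ≟ˢ work _   = no λ ()
tally    ≟ˢ letter _ = no λ ()
tally    ≟ˢ tally    = yes refl
tally    ≟ˢ #        = no λ ()
tally    ≟ˢ work _   = no λ ()
#        ≟ˢ letter _ = no λ ()
#        ≟ˢ tally    = no λ ()
#        ≟ˢ #        = yes refl
#        ≟ˢ work _   = no λ ()
work _   ≟ˢ letter _ = no λ ()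
work _   ≟ˢ tally    = no λ ()
work _   ≟ˢ #        = no λ ()
work a   ≟ˢ work b   = map′ (cong work) (λ where refl → refl) (a Fin.≟ b)

isSeparator : ∀ {s w} → Symbol s w → Bool
isSeparator # = true
isSeparator _ = false

encode-separatorFree : ∀ {s w} (y : Instance s) →
                       All (λ a → isSeparator a ≡ false) (encode {s} {w} y)
encode-separatorFree (x , k) =
  All.++⁺ (All.map⁺ (All.universal (λ _ → refl) x)) (All.replicate⁺ k refl)

length-encode : ∀ {s w} (y : Instance s) → length (encode {s} {w} y) ≡ size y
length-encode (x , k) =
  trans (length-++ (List.map letter x)) (cong₂ _+_ (length-map letter x) (length-replicate k))

-- The program compares codes, whereas the quasi-order speaks of instances. The code can be read
-- back because all letters precede all tallies.
encode-injective : ∀ {s w} x k x′ k′ →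
                   encode {s} {w} (x , k) ≡ encode (x′ , k′) → (x , k) ≡ (x′ , k′)
encode-injective []      zero    []        zero     _  = refl
encode-injective []      (suc k) []        (suc k′) eq
  with refl ← encode-injective [] k [] k′ (cong (drop 1) eq) = refl
encode-injective []      (suc k) (_ ∷ _)   _        ()
encode-injective (_ ∷ _) _       []        (suc _)  ()
encode-injective (a ∷ x) k       (a′ ∷ x′) k′       eq
  with refl , eq′ ← ∷-injective eq
  with refl ← encode-injective x k x′ k′ eq′ = refl

module Decide {s} (K : Machine s) where

  open Machine K using (w; extraStacks; start; code; _⇓[_]_)
  open Programs s w 4 extraStacks

  pattern A = zero
  pattern B = suc zero
  pattern C = suc (suc zero)
  pattern D = suc (suc (suc zero))
  pattern E = suc (suc (suc (suc zero)))
  pattern I = suc (suc (suc (suc (suc zero))))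

  separate scan rest accept measure restart continue body main decider : Program

  separate = loop A (maybe isSeparator true) (maybe (push B) skip)

  -- Together, scan and rest compare the words on B and C: they put a mark on E
  -- for every difference, and copies of the words on A, on D and on I, where K
  -- takes its input.

  scan = each C λ a → push A a ⨾ push I a ⨾
    case B (maybe (λ b → push D b ⨾ (if does (a ≟ˢ b) then skip else push E tally))
                  (push E tally))

  rest = each B λ b → push D b ⨾ push E tally

  accept = clear A ⨾ push A tally

  -- Compares lengths by cancelling: `A` loses a symbol for each symbol of the output of `K`, so it
  -- stays nonempty exactly if the output is shorter. The output survives in reverse on `C`.
  measure = each I λ a → push C a ⨾ case A (const skip)

  restart = clear A ⨾ move C A ⨾ push E tally

  -- `K` expects all its stacks but the first to be empty, hence the clearing for the sake of the
  -- next call. If `A` is empty at the end, it already holds the code of `false`.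
  continue = clear E ⨾ move D B ⨾ call start code ⨾
    clearAll (λ i → 6 ↑ʳ i) ⨾ measure ⨾ case A (maybe (const restart) skip)

  -- The stack A holds the current instance, and B the target in reverse.

  body = move A C ⨾ scan ⨾ rest ⨾ case E (maybe (const continue) accept)

  -- Between rounds `E` is a flag, and a tally on it requests another round; within a round it
  -- collects the differences.
  main = each E (const body)

  decider = separate ⨾ push E tally ⨾ main

  -- Correctness and cost of the parts of the decision program

  separate-run : ∀ {u v} → All (λ a → isSeparator a ≡ false) u → ∀ {b τ} →
    separate ⊢ (u List.++ # ∷ v) ∷ b ∷ τ ⟶[ suc (length u * 2) ] v ∷ (u ʳ++ b) ∷ τ
  separate-run []       = exit refl
  separate-run (p ∷ ps) = again p push (separate-run ps)

  -- What `scan` and `rest` together leave on `E`. Marks are only ever added, so starting from the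
  -- empty word the result is empty exactly for equal words.
  marks : Word → Word → Word → Word
  marks []      []      e = e
  marks []      (_ ∷ b) e = marks [] b (tally ∷ e)
  marks (_ ∷ c) []      e = marks c [] (tally ∷ e)
  marks (x ∷ c) (y ∷ b) e = marks c b (if does (x ≟ˢ y) then e else tally ∷ e)

  marks-∷ : ∀ c b {x e} → marks c b (x ∷ e) ≢ []
  marks-∷ (_ ∷ c) []      eq = marks-∷ c [] eq
  marks-∷ []      (_ ∷ b) eq = marks-∷ [] b eq
  marks-∷ (x ∷ c) (y ∷ b) eq with x ≟ˢ y
  ... | yes _ = marks-∷ c b eq
  ... | no  _ = marks-∷ c b eq

  marks-[] : ∀ c b → marks c b [] ≡ [] → c ≡ b
  marks-[] []      []      eq = refl
  marks-[] []      (_ ∷ b) eq = contradiction eq (marks-∷ [] b)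
  marks-[] (_ ∷ c) []      eq = contradiction eq (marks-∷ c [])
  marks-[] (x ∷ c) (y ∷ b) eq with x ≟ˢ y
  ... | yes refl = cong (x ∷_) (marks-[] c b eq)
  ... | no  _    = contradiction eq (marks-∷ c b)

  marks-refl : ∀ c → marks c c [] ≡ []
  marks-refl []      = refl
  marks-refl (x ∷ c) with x ≟ˢ x
  ... | yes _  = marks-refl c
  ... | no x≢x = contradiction refl x≢x

  length-marks : ∀ c b e → length (marks c b e) ≤ length c + length b + length e
  length-marks []      []      e = ≤-refl
  length-marks []      (_ ∷ b) e =
    ≤-trans (length-marks [] b (tally ∷ e)) (≤-reflexive (+-suc (length b) (length e)))
  length-marks (_ ∷ c) []      e =
    ≤-trans (length-marks c [] (tally ∷ e)) (≤-reflexive (+-suc (length c + 0) (length e)))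
  length-marks (x ∷ c) (y ∷ b) e with x ≟ˢ y
  ... | yes _ = ≤-trans (length-marks c b e)
    (m≤n⇒m≤1+n (+-monoˡ-≤ (length e) (+-monoʳ-≤ (length c) (n≤1+n (length b)))))
  ... | no  _ = ≤-trans (length-marks c b (tally ∷ e))
    (≤-trans (≤-reflexive (+-suc (length c + length b) (length e)))
      (s≤s (+-monoˡ-≤ (length e) (+-monoʳ-≤ (length c) (n≤1+n (length b))))))

  -- The last two equations are invariants: what remains on `B` has yet to be reversed onto `D` and
  -- to contribute its marks, which is the task of `rest`. They spare a case distinction on which
  -- word is longer.
  scan-run : ∀ {N} c → length c ≤ N → ∀ a b d e i {τ} → ∃[ b′ ] ∃[ d′ ] ∃[ e′ ]
    (scan ⊢ a ∷ b ∷ c ∷ d ∷ e ∷ i ∷ τ ⟶[ suc (N * 6) ]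
       (c ʳ++ a) ∷ b′ ∷ [] ∷ d′ ∷ e′ ∷ (c ʳ++ i) ∷ τ ×
     length b′ ≤ length b × b′ ʳ++ d′ ≡ b ʳ++ d × marks [] b′ e′ ≡ marks c b e)
  scan-run [] z≤n a b d e i =
    b , d , e , weaken (s≤s z≤n) (exit refl) , ≤-refl , refl , refl
  scan-run (x ∷ c) (s≤s c≤N) a [] d e i =
    let b′ , d′ , e′ , run , eqs = scan-run c c≤N (x ∷ a) [] d (tally ∷ e) (x ∷ i)
    in b′ , d′ , e′ ,
       -- With `B` exhausted the body takes 4 steps; 5 is the cost when both words still have a
       -- symbol.
       again refl (weaken {t′ = 5} (s≤s (s≤s (s≤s (s≤s z≤n)))) (push ⨾ push ⨾ case push)) run ,
       eqs
  scan-run (x ∷ c) (s≤s c≤N) a (y ∷ b) d e i {τ} =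
    let b′ , d′ , e′ , run , b′≤b , eqs = scan-run c c≤N (x ∷ a) b (y ∷ d) _ (x ∷ i)
    in b′ , d′ , e′ , again refl (push ⨾ push ⨾ case (push ⨾ mark (does (x ≟ˢ y)))) run ,
       m≤n⇒m≤1+n b′≤b , eqs
    where
    mark : ∀ same → (if same then skip else push E tally)
      ⊢ (x ∷ a) ∷ b ∷ c ∷ (y ∷ d) ∷ e ∷ (x ∷ i) ∷ τ ⟶[ 1 ]
        (x ∷ a) ∷ b ∷ c ∷ (y ∷ d) ∷ (if same then e else tally ∷ e) ∷ (x ∷ i) ∷ τ
    mark true  = weaken z≤n skip
    mark false = push

  rest-run : ∀ {N} b → length b ≤ N → ∀ {a c d e τ} →
    rest ⊢ a ∷ b ∷ c ∷ d ∷ e ∷ τ ⟶[ suc (N * 3) ]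
      a ∷ [] ∷ c ∷ (b ʳ++ d) ∷ marks [] b e ∷ τ
  rest-run []      z≤n       = weaken (s≤s z≤n) (exit refl)
  rest-run (x ∷ b) (s≤s b≤N) = again refl (push ⨾ push) (rest-run b b≤N)

  measure-run : ∀ {N} i → length i ≤ N → ∀ a {b c d e τ} →
    measure ⊢ a ∷ b ∷ c ∷ d ∷ e ∷ i ∷ τ ⟶[ suc (N * 3) ]
      drop (length i) a ∷ b ∷ (i ʳ++ c) ∷ d ∷ e ∷ [] ∷ τ
  measure-run []      z≤n       a       = weaken (s≤s z≤n) (exit refl)
  measure-run (x ∷ i) (s≤s i≤N) []      {b} {c} {d} {e} {τ} =
    arrive (cong (_∷ b ∷ (i ʳ++ x ∷ c) ∷ d ∷ e ∷ [] ∷ τ) (drop-[] (length i)))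
      (again refl (push ⨾ case skip) (measure-run i i≤N []))
  measure-run (x ∷ i) (s≤s i≤N) (_ ∷ a) =
    again refl (push ⨾ case skip) (measure-run i i≤N a)

  no-junk : Vec Word extraStacks
  no-junk = Vec.replicate extraStacks []

  -- N bounds the sizes of the instances, and T the running time of K.

  acceptTime continueTime restartTime bodyTime : ℕ → ℕ → ℕ
  acceptTime N T   = suc (N * 1) + 1
  restartTime N T  = suc (N * 1) + (suc ((N + T) * 2) + 1)
  continueTime N T = suc ((N + N) * 1) + (suc (N * 2) + (T +
    (N + T + extraStacks + (suc ((N + T) * 3) + suc (restartTime N T)))))
  -- Nested like `body`, so that the costs of its parts compose to it definitionally. The sum of the
  -- times of the two branches stands for their maximum.
  bodyTime N T     = suc (N * 2) + (suc (N * 6) + (suc (N * 3) +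
    suc (acceptTime N T + continueTime N T)))

  -- `u` is the target, `v` the current word and `v′` the output of `K` on it. Only `restarted`
  -- fixes the whole store, because only then does another round follow; otherwise the empty `E`
  -- ends the main loop.
  data Outcome (u v v′ : Word) : Store → Set where
    accepted  : ∀ {b c d τ} → v ≡ u →
                Outcome u v v′ ((tally ∷ []) ∷ b ∷ c ∷ d ∷ [] ∷ τ)
    rejected  : ∀ {b c d τ} → v ≢ u → length v ≤ length v′ →
                Outcome u v v′ ([] ∷ b ∷ c ∷ d ∷ [] ∷ τ)
    restarted : v ≢ u → length v′ < length v →
                Outcome u v v′
                  (v′ ∷ reverse u ∷ [] ∷ [] ∷ (tally ∷ []) ∷ [] ∷ no-junk)

  module _ {N T t : ℕ} {u v v′ : Word} {τ : Vec Word extraStacks}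
           (u≤N : length u ≤ N) (v≤N : length v ≤ N) (t≤T : t ≤ T)
           (K-run : (start , v ∷ no-junk) ⇓[ t ] (v′ ∷ τ)) where

    total≤ : total (v′ ∷ τ) ≤ N + T
    total≤ = begin
      total (v′ ∷ τ)               ≤⟨ total-run K-run ⟩
      length v + total no-junk + t ≡⟨ cong (λ n → length v + n + t)
                                        (total-replicate extraStacks) ⟩
      length v + 0 + t             ≡⟨ cong (_+ t) (+-identityʳ (length v)) ⟩
      length v + t                 ≤⟨ +-mono-≤ v≤N t≤T ⟩
      N + T                        ∎
      where open ≤-Reasoning

    v′≤ : length v′ ≤ N + T
    v′≤ = ≤-trans (m≤m+n (length v′) (total τ)) total≤

    restart-run : ∀ x a → length (x ∷ a) ≤ N →
      case A (maybe (const restart) skip)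
        ⊢ (x ∷ a) ∷ reverse u ∷ reverse v′ ∷ [] ∷ [] ∷ [] ∷ no-junk
        ⟶[ suc (restartTime N T) ]
        v′ ∷ reverse u ∷ [] ∷ [] ∷ (tally ∷ []) ∷ [] ∷ no-junk
    restart-run x a a<N = case
      (clear-run (λ a → a ∷ reverse u ∷ reverse v′ ∷ [] ∷ [] ∷ [] ∷ no-junk)
         (λ _ → refl) (λ _ _ → refl) a (<⇒≤ a<N)
       ⨾ arrive (cong (_∷ _) (reverse-involutive v′))
           (move-run (λ c a → a ∷ reverse u ∷ c ∷ [] ∷ [] ∷ [] ∷ no-junk)
             (λ _ _ → refl) (λ _ _ _ → refl) (λ _ _ → refl) (λ _ _ _ → refl)
             (reverse v′) [] (≤-trans (≤-reflexive (length-reverse v′)) v′≤))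
       ⨾ push)

    -- A variable with an equation, instead of the `drop` itself, allows matching on the word on
    -- `A`. Its length is a truncated difference, which vanishes exactly if `v` is no longer than
    -- `v′`.
    finish-run : v ≢ u → ∀ a → a ≡ drop (length v′) v → ∃[ σ ]
      (case A (maybe (const restart) skip)
         ⊢ a ∷ reverse u ∷ reverse v′ ∷ [] ∷ [] ∷ [] ∷ no-junk
         ⟶[ suc (restartTime N T) ] σ × Outcome u v v′ σ)
    finish-run v≢u [] eq =
      _ , weaken (s≤s z≤n) (case skip) ,
      rejected v≢u (m∸n≡0⇒m≤n
        (trans (sym (length-drop (length v′) v)) (sym (cong length eq))))
    finish-run v≢u (x ∷ a) eq =
      _ ,
      restart-run x a
        (≤-trans (≤-trans (≤-reflexive a-length) (m∸n≤m (length v) (length v′))) v≤N) ,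
      restarted v≢u (m∸n≢0⇒n<m λ eq′ → contradiction (trans a-length eq′) (λ ()))
      where
      a-length : suc (length a) ≡ length v ∸ length v′
      a-length = trans (cong length eq) (length-drop (length v′) v)

    continue-run : v ≢ u → ∀ e → length e ≤ N + N → ∃[ σ ]
      (continue ⊢ v ∷ [] ∷ [] ∷ u ∷ e ∷ v ∷ no-junk ⟶[ continueTime N T ] σ ×
       Outcome u v v′ σ)
    continue-run v≢u e e≤ =
      let σ , run , outcome = finish-run v≢u _ refl
      in σ ,
        (clear-run (λ e → v ∷ [] ∷ [] ∷ u ∷ e ∷ v ∷ no-junk)
           (λ _ → refl) (λ _ _ → refl) e e≤
         ⨾ move-run (λ d b → v ∷ b ∷ [] ∷ d ∷ [] ∷ v ∷ no-junk)
             (λ _ _ → refl) (λ _ _ _ → refl) (λ _ _ → refl) (λ _ _ _ → refl)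
             u [] u≤N
         ⨾ weaken t≤T (call (v ∷ reverse u ∷ [] ∷ [] ∷ [] ∷ []) K-run)
         ⨾ weaken (+-monoˡ-≤ extraStacks (≤-trans (m≤n+m (total τ) (length v′)) total≤))
             (clearAll-run (λ τ → v ∷ reverse u ∷ [] ∷ [] ∷ [] ∷ v′ ∷ τ)
               (λ _ _ → refl) (λ _ _ _ → refl) τ)
         ⨾ measure-run v′ v′≤ v
         ⨾ run) ,
        outcome

    branch-run : ∀ e → e ≡ marks (reverse v) (reverse u) [] → ∃[ σ ]
      (case E (maybe (const continue) accept)
         ⊢ v ∷ [] ∷ [] ∷ u ∷ e ∷ v ∷ no-junk
         ⟶[ suc (acceptTime N T + continueTime N T) ] σ × Outcome u v v′ σ)
    branch-run [] eq =
      _ ,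
      case (weaken (m≤m+n (acceptTime N T) (continueTime N T))
        (clear-run (λ a → a ∷ [] ∷ [] ∷ u ∷ [] ∷ v ∷ no-junk)
           (λ _ → refl) (λ _ _ → refl) v v≤N
         ⨾ push)) ,
      accepted (reverse-injective (marks-[] (reverse v) (reverse u) (sym eq)))
    branch-run (x ∷ e) eq =
      let σ , run , outcome = continue-run v≢u e e≤
      in σ , case (weaken (m≤n+m (continueTime N T) (acceptTime N T)) run) , outcome
      where
      v≢u : v ≢ u
      v≢u refl = contradiction (trans eq (marks-refl (reverse v))) λ ()
      e≤ : length e ≤ N + N
      e≤ = begin
        length e                                    ≤⟨ n≤1+n _ ⟩
        length (x ∷ e)                              ≡⟨ cong length eq ⟩
        length (marks (reverse v) (reverse u) [])   ≤⟨ length-marks (reverse v) (reverse u) [] ⟩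
        length (reverse v) + length (reverse u) + 0 ≡⟨ +-identityʳ _ ⟩
        length (reverse v) + length (reverse u)     ≡⟨ cong₂ _+_ (length-reverse v)
                                                                (length-reverse u) ⟩
        length v + length u                         ≤⟨ +-mono-≤ v≤N u≤N ⟩
        N + N                                       ∎
        where open ≤-Reasoning

    -- Every transfer reverses a word, and the reversals pair up: `v` meets the target with both
    -- reversed, then returns upright to `A` and to `I`, while `u` lies upright on `D`, to be
    -- reversed again when it goes back to `B`.
    body-run : ∃[ σ ]
      (body ⊢ v ∷ reverse u ∷ [] ∷ [] ∷ [] ∷ [] ∷ no-junk ⟶[ bodyTime N T ] σ ×
       Outcome u v v′ σ)
    body-run =
      let b , d , e , scanned , b≤ , ds , es =
            scan-run {N} (reverse v) (≤-trans (≤-reflexive (length-reverse v)) v≤N)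
              [] (reverse u) [] [] [] {no-junk}
          σ , run , outcome = branch-run _ es
      in σ ,
        (move-run (λ a c → a ∷ reverse u ∷ c ∷ [] ∷ [] ∷ [] ∷ no-junk)
           (λ _ _ → refl) (λ _ _ _ → refl) (λ _ _ → refl) (λ _ _ _ → refl) v [] v≤N
         ⨾ arrive (cong (λ z → z ∷ b ∷ [] ∷ d ∷ e ∷ z ∷ no-junk) (reverse-involutive v))
             scanned
         ⨾ arrive (cong (λ z → v ∷ [] ∷ [] ∷ z ∷ marks [] b e ∷ v ∷ no-junk)
                      (trans ds (reverse-involutive u)))
             (rest-run b (≤-trans b≤ (≤-trans (≤-reflexive (length-reverse u)) u≤N)))
         ⨾ run) ,
        outcome

  -- The quasi-order and its decision

  module Reduction (reduce : Instance s → Instance s) {T : ℕ → ℕ}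
    (T-mono : ∀ {m n} → m ≤ n → T m ≤ T n)
    (K-computes : ∀ z → ∃[ t ]
      (Machine._computes_inTime_ K (encode {s} {w} z) (encode {s} {w} (reduce z)) t ×
       t ≤ T (size z))) where

    Shrinks : Rel (Instance s) 0ℓ
    Shrinks z z′ = z′ ≡ reduce z × size z′ < size z

    _≼_ : Rel (Instance s) 0ℓ
    _≼_ = flip (Star Shrinks)

    ≼-isPreorder : IsPreorder _≡_ _≼_
    ≼-isPreorder = Flip.isPreorder (Star.isPreorder Shrinks)

    decisionTime : ℕ → ℕ
    decisionTime N = suc (N * 2) + (1 + suc (suc N * suc (bodyTime N (T N))))

    lastRound : ∀ c n → suc (c + 1) ≤ suc (suc n * suc c)
    lastRound c n = s≤s (≤-trans (≤-reflexive (+-comm c 1)) (m≤m+n (suc c) (n * suc c)))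

    -- Two bounds play different parts: `n` limits the remaining rounds and drops with the size,
    -- while `N` stays fixed, so that all rounds have the same cost.
    main-run : ∀ {N y} → size y ≤ N → ∀ n z → size z < n → size z ≤ N → ∃[ b ] ∃[ σ ]
      (main ⊢ encode z ∷ reverse (encode y) ∷ [] ∷ [] ∷ (tally ∷ []) ∷ [] ∷ no-junk
         ⟶[ suc (n * suc (bodyTime N (T N))) ] σ ×
       Vec.head σ ≡ encodeBool b × Reflects (y ≼ z) b)
    main-run {N} {y} y≤N (suc n) z (s≤s z≤n′) z≤N
      with t , (v′ ∷ τ , K-run , refl) , t≤ ← K-computes z
      with body-run (≤-trans (≤-reflexive (length-encode y)) y≤N)
             (≤-trans (≤-reflexive (length-encode z)) z≤N)
             (≤-trans t≤ (T-mono z≤N)) K-run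
    ... | _ , run , accepted eq =
      true , _ , weaken (lastRound (bodyTime N (T N)) n)
        (again refl run (exit refl)) , refl ,
      ofʸ (subst (Star Shrinks z) (encode-injective _ _ _ _ eq) ε)
    ... | _ , run , rejected z≢y z≤ =
      false , _ , weaken (lastRound (bodyTime N (T N)) n)
        (again refl run (exit refl)) , refl ,
      ofⁿ λ where
        ε                  → z≢y refl
        ((refl , lt) ◅ _) → <⇒≱ lt
          (subst₂ _≤_ (length-encode z) (length-encode (reduce z)) z≤)
    ... | _ , run , restarted z≢y lt =
      let lt′ = subst₂ _<_ (length-encode (reduce z)) (length-encode z) lt
          b , σ , run′ , out , y≼z =
            main-run y≤N n (reduce z) (<-≤-trans lt′ z≤n′) (≤-trans (<⇒≤ lt′) z≤N)
      in b , σ ,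
         weaken (s≤s (≤-reflexive (+-suc (bodyTime N (T N)) _))) (again refl run run′) , out ,
         descend lt′ y≼z
      where
      -- `Shrinks` is a partial function, so every nonempty chain from `z` passes through
      -- `reduce z`; the empty one is excluded by `z≢y`.
      descend : ∀ {b} → size (reduce z) < size z →
                Reflects (y ≼ reduce z) b → Reflects (y ≼ z) b
      descend lt (ofʸ path)  = ofʸ ((refl , lt) ◅ path)
      descend lt (ofⁿ ¬path) = ofⁿ λ where
        ε                    → z≢y refl
        ((refl , _) ◅ path) → ¬path path

    decides : ∀ y z → ∃[ b ] ∃[ t ]
      (Machine._computes_inTime_ (Compile.compiled decider) (encodePair y z) (encodeBool b) t ×
       t ≤ decisionTime (size y + size z) × Reflects (y ≼ z) b)
    decides y z =
      let b , σ , run , out , y≼z = main-run (m≤m+n (size y) (size z)) (suc (size y + size z)) z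
            (s≤s (m≤n+m (size z) (size y))) (m≤n+m (size z) (size y))
          t , computes , t≤ = Compile.compiled-correct decider
            (weaken (s≤s (*-monoˡ-≤ 2
                (≤-trans (≤-reflexive (length-encode y)) (m≤m+n (size y) (size z)))))
               (separate-run (encode-separatorFree y))
             ⨾ push ⨾ run)
      in b , t ,
         subst (λ v → Machine._computes_inTime_ (Compile.compiled decider) _ v t) out computes ,
         t≤ , y≼z

-- Polynomial bounds

n^d≥1 : ∀ d {n} → 1 ≤ n → 1 ≤ n ^ d
n^d≥1 d {suc n} _ = m^n>0 (suc n) d

^-monoʳ : ∀ {n d e} → 1 ≤ n → d ≤ e → n ^ d ≤ n ^ e
^-monoʳ {suc n} _ = ^-monoʳ-≤ (suc n)

polynomial-const : ∀ m → PolynomiallyBounded (const m)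
polynomial-const m = 0 , m , 0 , λ _ _ → ≤-reflexive (sym (*-identityʳ m))

polynomial-id : PolynomiallyBounded (λ n → n)
polynomial-id = 1 , 1 , 0 , λ n _ →
  ≤-reflexive (sym (trans (*-identityˡ (n ^ 1)) (*-identityʳ n)))

polynomial-+ : ∀ {g h} → PolynomiallyBounded g → PolynomiallyBounded h →
               PolynomiallyBounded (λ n → g n + h n)
polynomial-+ {g} {h} (d , C , n₀ , g≤) (d′ , C′ , n₀′ , h≤) =
  -- The additional 1 keeps `n` positive: at 0 a power can decrease as its exponent grows, from
  -- `0 ^ 0` to `0 ^ 1`.
  d + d′ , C + C′ , 1 + (n₀ + n₀′) , λ n n≥ →
    let n≥1  = ≤-trans (s≤s z≤n) n≥
        n≥n₀ = ≤-trans (n≤1+n (n₀ + n₀′)) n≥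
    in begin
      g n + h n                           ≤⟨ +-mono-≤ (g≤ n (≤-trans (m≤m+n n₀ n₀′) n≥n₀))
                                                      (h≤ n (≤-trans (m≤n+m n₀′ n₀) n≥n₀)) ⟩
      C * n ^ d + C′ * n ^ d′             ≤⟨ +-mono-≤ (*-monoʳ-≤ C (^-monoʳ n≥1 (m≤m+n d d′)))
                                                      (*-monoʳ-≤ C′ (^-monoʳ n≥1 (m≤n+m d′ d))) ⟩
      C * n ^ (d + d′) + C′ * n ^ (d + d′) ≡⟨ *-distribʳ-+ (n ^ (d + d′)) C C′ ⟨
      (C + C′) * n ^ (d + d′)             ∎
  where open ≤-Reasoning

polynomial-* : ∀ {g h} → PolynomiallyBounded g → PolynomiallyBounded h →
               PolynomiallyBounded (λ n → g n * h n)
polynomial-* {g} {h} (d , C , n₀ , g≤) (d′ , C′ , n₀′ , h≤) =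
  d + d′ , C * C′ , n₀ + n₀′ , λ n n≥ → begin
    g n * h n                   ≤⟨ *-mono-≤ (g≤ n (≤-trans (m≤m+n n₀ n₀′) n≥))
                                            (h≤ n (≤-trans (m≤n+m n₀′ n₀) n≥)) ⟩
    (C * n ^ d) * (C′ * n ^ d′) ≡⟨ [m*n]*[o*p]≡[m*o]*[n*p] C (n ^ d) C′ (n ^ d′) ⟩
    (C * C′) * (n ^ d * n ^ d′) ≡⟨ cong (C * C′ *_) (^-distribˡ-+-* n d d′) ⟨
    (C * C′) * n ^ (d + d′)     ∎
  where open ≤-Reasoning

polynomial-suc : ∀ {g} → PolynomiallyBounded g → PolynomiallyBounded (suc ∘ g)
polynomial-suc = polynomial-+ (polynomial-const 1)

sumBelow : (ℕ → ℕ) → ℕ → ℕ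
sumBelow h zero    = 0
sumBelow h (suc n) = h n + sumBelow h n

term≤sumBelow : ∀ h {m n} → m < n → h m ≤ sumBelow h n
term≤sumBelow h {m} {suc n} (s≤s m≤n) with m≤n⇒m<n∨m≡n m≤n
... | inj₁ m<n  = ≤-trans (term≤sumBelow h m<n) (m≤n+m (sumBelow h n) (h n))
... | inj₂ refl = m≤m+n (h m) (sumBelow h m)

monomial : ℕ → ℕ → ℕ → ℕ → ℕ
monomial C D d n = D + C * n ^ d

-- The constant term absorbs the exempt arguments; the sum of the values there serves as their
-- maximum.
∈O⇒≤monomial : ∀ {h d} → h ∈O (_^ d) → ∃[ C ] ∃[ D ] (∀ n → h n ≤ monomial C D d n)
∈O⇒≤monomial {h} {d} (C , n₀ , h≤) = C , sumBelow h n₀ , bound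
  where
  bound : ∀ n → h n ≤ sumBelow h n₀ + C * n ^ d
  bound n with n₀ ≤? n
  ... | yes n₀≤n = ≤-trans (h≤ n n₀≤n) (m≤n+m _ (sumBelow h n₀))
  ... | no  n₀≰n = ≤-trans (term≤sumBelow h (≰⇒> n₀≰n)) (m≤m+n _ (C * n ^ d))

monomial-∈O : ∀ C D d → monomial C D d ∈O (_^ d)
monomial-∈O C D d = D + C , 1 , λ n n≥1 → begin
  D + C * n ^ d         ≤⟨ +-monoˡ-≤ (C * n ^ d) (≤-trans (≤-reflexive (sym (*-identityʳ D)))
                                                          (*-monoʳ-≤ D (n^d≥1 d n≥1))) ⟩
  D * n ^ d + C * n ^ d ≡⟨ *-distribʳ-+ (n ^ d) D C ⟨
  (D + C) * n ^ d       ∎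
  where open ≤-Reasoning

monomial-mono : ∀ C D d {m n} → m ≤ n → monomial C D d m ≤ monomial C D d n
monomial-mono C D d m≤n = +-monoʳ-≤ D (*-monoʳ-≤ C (^-monoˡ-≤ d m≤n))

-- A machine computing D + C n^d

module ComputeMonomial where

  open Programs 0 0 3 0

  pushes : ℕ → Program
  pushes zero    = skip
  pushes (suc m) = pushes m ⨾ push zero tally

  -- `P` is the accumulator, `N` keeps the argument, `Q` counts the additions of a multiplication,
  -- and `R` holds the copy from which `N` is restored.
  pattern P = zero
  pattern N = suc zero
  pattern Q = suc (suc zero)
  pattern R = suc (suc (suc zero))

  add multiply : Program
  add      = each N (λ _ → push P tally ⨾ push R tally) ⨾ move R N
  multiply = move P Q ⨾ each Q (const add)

  multiplyBy^ : ℕ → Program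
  multiplyBy^ zero    = skip
  multiplyBy^ (suc d) = multiply ⨾ multiplyBy^ d

  program : ℕ → ℕ → ℕ → Program
  program C D d = move P N ⨾ pushes C ⨾ multiplyBy^ d ⨾ pushes D

  numbers : ℕ → ℕ → ℕ → ℕ → Store
  numbers p n q r = encodeℕ p ∷ encodeℕ n ∷ encodeℕ q ∷ encodeℕ r ∷ [] ∷ []

  _⊢_⟶_ : Program → Store → Store → Set
  p ⊢ σ ⟶ σ′ = ∃[ t ] (p ⊢ σ ⟶[ t ] σ′)

  infixr 4 _then_
  infix 3 _⊢_⟶_

  _then_ : ∀ {p q σ σ′ σ″} → p ⊢ σ ⟶ σ′ → q ⊢ σ′ ⟶ σ″ → (p ⨾ q) ⊢ σ ⟶ σ″
  (_ , run) then (_ , run′) = _ , run ⨾ run′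

  -- A unary numeral is its own reversal, so a reversing transfer amounts to addition.
  moved : ∀ {p σ τ} (S : Word → Store) m n → p ⊢ σ ⟶ S (encodeℕ m List.ʳ++ encodeℕ n) →
          τ ≡ S (encodeℕ (m + n)) → p ⊢ σ ⟶ τ
  moved S zero    n run refl = run
  moved S (suc m) n run refl = moved S m (suc n) run (cong (S ∘ encodeℕ) (sym (+-suc m n)))

  pushes-run : ∀ m {p n} → pushes m ⊢ numbers p n 0 0 ⟶ numbers (m + p) n 0 0
  pushes-run zero    = _ , skip
  pushes-run (suc m) = pushes-run m then (_ , push)

  count-run : ∀ n p q r → each N (λ _ → push P tally ⨾ push R tally)
    ⊢ numbers p n q r ⟶ numbers (n + p) 0 q (n + r)
  count-run zero    p q r = _ , exit refl
  count-run (suc n) p q r =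
    let t , run = count-run n (suc p) q (suc r)
    in _ , again refl (push ⨾ push)
         (arrive (cong₂ (λ x y → numbers x 0 q y) (+-suc n p) (+-suc n r)) run)

  add-run : ∀ n p q → add ⊢ numbers p n q 0 ⟶ numbers (n + p) n q 0
  add-run n p q = count-run n p q 0 then
    moved (λ v → encodeℕ (n + p) ∷ v ∷ encodeℕ q ∷ [] ∷ [] ∷ []) (n + 0) 0
      (_ , move-run (λ u v → encodeℕ (n + p) ∷ v ∷ encodeℕ q ∷ u ∷ [] ∷ [])
             (λ _ _ → refl) (λ _ _ _ → refl) (λ _ _ → refl) (λ _ _ _ → refl)
             (encodeℕ (n + 0)) [] ≤-refl)
      (cong (λ x → numbers (n + p) x q 0)
        (sym (trans (+-identityʳ (n + 0)) (+-identityʳ n))))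

  addLoop-run : ∀ q n p → each Q (const add) ⊢ numbers p n q 0 ⟶ numbers (q * n + p) n 0 0
  addLoop-run zero    n p = _ , exit refl
  addLoop-run (suc q) n p =
    let _ , run  = add-run n p q
        _ , run′ = addLoop-run q n (n + p)
    in _ , again refl run (arrive (cong (λ x → numbers x n 0 0) eq) run′)
    where
    eq : q * n + (n + p) ≡ suc q * n + p
    eq = trans (sym (+-assoc (q * n) n p)) (cong (_+ p) (+-comm (q * n) n))

  multiply-run : ∀ p n → multiply ⊢ numbers p n 0 0 ⟶ numbers (p * n) n 0 0
  multiply-run p n =
    moved (λ v → [] ∷ encodeℕ n ∷ v ∷ [] ∷ [] ∷ []) p 0
      (_ , move-run (λ u v → u ∷ encodeℕ n ∷ v ∷ [] ∷ [] ∷ [])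
             (λ _ _ → refl) (λ _ _ _ → refl) (λ _ _ → refl) (λ _ _ _ → refl)
             (encodeℕ p) [] ≤-refl)
      (cong (λ x → numbers 0 n x 0) (sym (+-identityʳ p)))
    then
    subst (λ x → each Q (const add) ⊢ numbers 0 n p 0 ⟶ numbers x n 0 0)
      (+-identityʳ (p * n)) (addLoop-run p n 0)

  multiplyBy^-run : ∀ d p n → multiplyBy^ d ⊢ numbers p n 0 0 ⟶ numbers (p * n ^ d) n 0 0
  multiplyBy^-run zero    p n = _ , arrive (cong (λ x → numbers x n 0 0) (sym (*-identityʳ p))) skip
  multiplyBy^-run (suc d) p n =
    multiply-run p n then
    subst (λ x → multiplyBy^ d ⊢ numbers (p * n) n 0 0 ⟶ numbers x n 0 0)
      (*-assoc p n (n ^ d)) (multiplyBy^-run d (p * n) n)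

  program-run : ∀ C D d n → program C D d ⊢ numbers n 0 0 0 ⟶ numbers (monomial C D d n) n 0 0
  program-run C D d n =
    moved (λ v → [] ∷ v ∷ [] ∷ [] ∷ [] ∷ []) n 0
      (_ , move-run (λ u v → u ∷ v ∷ [] ∷ [] ∷ [] ∷ [])
             (λ _ _ → refl) (λ _ _ _ → refl) (λ _ _ → refl) (λ _ _ _ → refl)
             (encodeℕ n) [] ≤-refl)
      (cong (λ x → numbers 0 x 0 0) (sym (+-identityʳ n)))
    then
    subst (λ x → pushes C ⊢ numbers 0 n 0 0 ⟶ numbers x n 0 0) (+-identityʳ C) (pushes-run C) then
    multiplyBy^-run d C n then
    pushes-run D

  monomial-computable : ∀ C D d → Computable (monomial C D d)
  monomial-computable C D d = Compile.compiled (program C D d) , λ n →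
    let _ , run = program-run C D d n
        t , computes , _ = Compile.compiled-correct (program C D d) run
    in t , computes

-- Polynomial decision time, the ideal and the obstructions

bodyTime-polynomial : ∀ {s} (K : Machine s) {T} → PolynomiallyBounded T →
                      PolynomiallyBounded (λ N → Decide.bodyTime K N (T N))
bodyTime-polynomial K {T} poly-T =
  -- The shape is that of `bodyTime` unfolded. A `1+` extends over all that follows it, which fits
  -- because `suc a + b` reduces to `suc (a + b)`.
  1+ n *ₙ 2 ⊹ 1+ n *ₙ 6 ⊹ 1+ n *ₙ 3 ⊹ 1+ 1+ (n *ₙ 1 ⊹ polynomial-const 1) ⊹
  1+ (n ⊹ n) *ₙ 1 ⊹ 1+ n *ₙ 2 ⊹ poly-T ⊹
  ((n ⊹ poly-T) ⊹ polynomial-const (Machine.extraStacks K)) ⊹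
  1+ (n ⊹ poly-T) *ₙ 3 ⊹ 1+ 1+ n *ₙ 1 ⊹ 1+ (n ⊹ poly-T) *ₙ 2 ⊹ polynomial-const 1
  where
  infixr 6 _⊹_
  infix  7 _*ₙ_
  infixr 6 1+_
  n : PolynomiallyBounded (λ n → n)
  n = polynomial-id
  1+_ : ∀ {g} → PolynomiallyBounded g → PolynomiallyBounded (λ n → suc (g n))
  1+_ = polynomial-suc
  _⊹_ : ∀ {g h} → PolynomiallyBounded g → PolynomiallyBounded h →
        PolynomiallyBounded (λ n → g n + h n)
  _⊹_ = polynomial-+
  _*ₙ_ : ∀ {g} → PolynomiallyBounded g → ∀ m → PolynomiallyBounded (λ n → g n * m)
  p *ₙ m = polynomial-* p (polynomial-const m)

corollary1 : (s c : ℕ) (Q : ParameterizedProblem s) →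
    DecidableProblem Q →
    ∃[ g ] (g ∈O (_^ c) × Kernel Q g) →
    Σ[ _≼_ ∈ Rel (Instance s) 0ℓ ] Σ[ f ∈ (ℕ → ℕ) ]
    (IsPreorder _≡_ _≼_ ×
    PolynomialTimeRelation _≼_ ×
    Computable f ×
    f ∈O (_^ c) ×
    LowerIdeal _≼_ Q ×
    (∀ y → ¬ Q y →
    ∃[ y′ ] (¬ Q y′ × size y′ ≤ f (parameter y) × y′ ≼ y)))
corollary1 s c Q _ (g , g∈O , K , T , (d , T∈O) , kernel)
  -- For `T` the gain is monotonicity, which bounds the later calls in a chain by the first size;
  -- for `g` it is computability, which makes the bound a legitimate choice of `f`.
  with C , D , T≤ ← ∈O⇒≤monomial {d = d} T∈O
  with C′ , D′ , g≤ ← ∈O⇒≤monomial {d = c} g∈O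
  = _≼_ , monomial C′ D′ c , ≼-isPreorder ,
    (Programs.Compile.compiled _ _ _ _ decider , decisionTime , decisionTime-polynomial ,
     decides) ,
    ComputeMonomial.monomial-computable C′ D′ c , monomial-∈O C′ D′ c ,
    flip lower , obstruction
  where
  reduce : Instance s → Instance s
  reduce z = proj₁ (kernel z)

  reduce-⇔ : ∀ z → Q z ⇔ Q (reduce z)
  reduce-⇔ z = let _ , _ , _ , _ , _ , eq = kernel z in eq

  reduce-small : ∀ z → size (reduce z) ≤ monomial C′ D′ c (parameter z)
  reduce-small z = let _ , _ , _ , _ , small , _ = kernel z in ≤-trans small (g≤ (parameter z))

  open Decide K using (decider; bodyTime; module Reduction)
  reduce-computed : ∀ z →
    ∃[ t ] (Machine._computes_inTime_ K (encode z) (encode (reduce z)) t ×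
            t ≤ monomial C D d (size z))
  reduce-computed z =
    let _ , t , computes , t≤ , _ = kernel z in t , computes , ≤-trans t≤ (T≤ (size z))

  open Reduction reduce {monomial C D d} (monomial-mono C D d) reduce-computed

  decisionTime-polynomial : PolynomiallyBounded decisionTime
  decisionTime-polynomial =
    polynomial-suc (polynomial-+ (polynomial-* polynomial-id (polynomial-const 2))
      (polynomial-suc (polynomial-suc (polynomial-suc (polynomial-+ poly
        (polynomial-* polynomial-id (polynomial-suc poly)))))))
    where
    poly : PolynomiallyBounded (λ N → bodyTime N (monomial C D d N))
    poly = bodyTime-polynomial K
      (polynomial-+ (polynomial-const D) (d , C , 0 , λ _ _ → ≤-refl))

  lower : ∀ {y z} → Star Shrinks z y → Q z → Q y
  lower ε                   Qz = Qz
  lower ((refl , _) ◅ path) Qz = lower path (Equivalence.to (reduce-⇔ _) Qz)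

  obstruction : ∀ y → ¬ Q y →
    ∃[ y′ ] (¬ Q y′ × size y′ ≤ monomial C′ D′ c (parameter y) × y′ ≼ y)
  obstruction y ¬Qy with size (reduce y) <? size y
  ... | yes lt = reduce y , ¬Qy ∘ Equivalence.from (reduce-⇔ y) , reduce-small y , (refl , lt) ◅ ε
  ... | no ≮   = y , ¬Qy , ≤-trans (≮⇒≥ ≮) (reduce-small y) , ε
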